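{- Let $\alpha=(\alpha_0,\ldots,\alpha_{n-1})\in Q_{n,2^n}$, and let $A$ be an $n\times n$ Boolean matrix that is domination-equivalent to the incidence matrix $M_\alpha$. If $A\mathbf{v}_n^T=\beta^T$, where $\mathbf{v}_n=(2^0,2^1,\ldots,2^{n-1})$ and the product is computed over the integers, then $\alpha$ and $\beta$ are Pascal-equivalent (where $\beta$ is regarded as an element of $Q_{n,2^n}$, i.e. as an unordered $n$-element subset of $\{0,\ldots,2^n-1\}$); equivalently, $\beta\in[\alpha]$.
   Context: $Q_{n,2^n}$ is the collection of $n$-element subsets of $\{0,1,\ldots,2^n-1\}$, whose elements may be listed as vectors $\alpha=(\alpha_0,\ldots,\alpha_{n-1})$ with distinct entries. The binary Pascal matrix $\mathbf{P}_{2^n}$ is the $2^n\times2^n$ $(0,1)$-matrix with $(\mathbf{P}_{2^n})_{i,j}\equiv\binom{i}{j}\pmod 2$, $0\le i,j\le 2^n-1$, and $\mathbf{P}_{2^n}[\alpha]$ is the $n\times n$ matrix with $(i,j)$ entry $(\mathbf{P}_{2^n})_{\alpha_i,\alpha_j}$. Two $n\times n$ matrices $M,N$ are permutation similar, $M\sim N$, if $N=Q^TMQ$ for some permutation matrix $Q$. $\alpha,\beta\in Q_{n,2^n}$ are Pascal-equivalent if $\mathbf{P}_{2^n}[\alpha]\sim\mathbf{P}_{2^n}[\beta]$ (this does not depend on the listing order); $[\alpha]$ is the Pascal-equivalence class of $\alpha$. Writing $\alpha_i=\sum_{j=0}^{n-1}b_{ij}2^j$ with $b_{ij}\in\{0,1\}$,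 the incidence matrix $M_\alpha$ is the $n\times n$ $(0,1)$-matrix with $(M_\alpha)_{i,j}=b_{ij}$. A Boolean matrix is a $(0,1)$-matrix. For row vectors, $R_i$ is dominated by $R_j$ if $R_i\le R_j$ entrywise. An $n\times n$ Boolean matrix $A$ is domination-equivalent to $M_\alpha$ if $A$ and $M_\alpha$ have identical domination relations among their rows, up to relabelling the rows: there is a permutation $\sigma$ of $\{0,\ldots,n-1\}$ such that for all $i,j$, row $i$ of $M_\alpha$ is $\le$ row $j$ of $M_\alpha$ if and only if row $\sigma(i)$ of $A$ is $\le$ row $\sigma(j)$ of $A$. -}

module Defs where

open import Algebra.Properties.Semiring.Sum using (sum)
open import Data.Bool.Base using (if_then_else_)
open import Data.Fin.Base using (Fin; toℕ)
open import Data.Fin.Permutation using (Permutation′; _⟨$⟩ʳ_)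
open import Data.Fin.Properties using (_≟_)
open import Data.Nat.Base using (ℕ; _*_; _^_; _%_; _/_; _≤_)
open import Data.Nat.Combinatorics using (_C_)
open import Data.Nat.Properties using (+-*-semiring; m^n≢0)
open import Data.Product.Base using (∃-syntax; _×_)
open import Data.Sum.Base using (_⊎_)
open import Data.Vec.Functional using (Vector; transpose)
open import Data.Vec.Functional.Relation.Binary.Pointwise using (Pointwise)
open import Function.Bundles using (_⇔_)
open import Function.Definitions using (Injective)
open import Relation.Binary.PropositionalEquality.Core using (_≡_)
open import Relation.Nullary.Decidable.Core using (does)

private
  variable
    m n : ℕ

Σ[_] : Vector ℕ n → ℕ
Σ[_] = sum +-*-semiring

-- All matrices and vectors here have nonnegative integer entries, so products
-- over ℕ and over ℤ coincide.
Matrix : ℕ → ℕ → Set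
Matrix m n = Vector (Vector ℕ n) m

infixl 7 _·_ _·ᵥ_

_·_ : ∀ {l} → Matrix l m → Matrix m n → Matrix l n
(M · N) i j = Σ[ (λ k → M i k * N k j) ]

_·ᵥ_ : Matrix m n → Vector ℕ n → Vector ℕ m
(M ·ᵥ v) i = Σ[ (λ k → M i k * v k) ]

IsBoolean : Matrix m n → Set
IsBoolean M = ∀ i j → M i j ≡ 0 ⊎ M i j ≡ 1

permutationMatrix : Permutation′ n → Matrix n n
permutationMatrix σ i j = if does (σ ⟨$⟩ʳ i ≟ j) then 1 else 0

infix 4 _∼_

_∼_ : Matrix n n → Matrix n n → Set
_∼_ {n} M N = ∃[ σ ] let P = permutationMatrix {n} σ in
  ∀ i j → N i j ≡ (transpose P · M · P) i j

-- An n-element subset of {0, …, 2ⁿ - 1}, presented by a listing of its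
-- elements.  Two listings of the same subset are different terms, but
-- PascalEquivalent below does not distinguish them.
record Q (n : ℕ) : Set where
  field
    elements : Vector (Fin (2 ^ n)) n
    distinct : Injective _≡_ _≡_ elements

open Q public

pascalMatrix : ∀ n → Matrix (2 ^ n) (2 ^ n)
pascalMatrix n i j = (toℕ i C toℕ j) % 2

pascalMatrix[_] : Q n → Matrix n n
pascalMatrix[_] {n} α i j = pascalMatrix n (elements α i) (elements α j)

PascalEquivalent : Q n → Q n → Set
PascalEquivalent α β = pascalMatrix[ α ] ∼ pascalMatrix[ β ]

-- The coefficient of 2ʲ in the binary expansion of a.
bit : ℕ → ℕ → ℕ
bit a j = (a / 2 ^ j) % 2
  where instance _ = m^n≢0 2 j

incidenceMatrix : Q n → Matrix n n
incidenceMatrix α i j = bit (toℕ (elements α i)) (toℕ j)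

infix 4 _⊑_

_⊑_ : Vector ℕ n → Vector ℕ n → Set
_⊑_ = Pointwise _≤_

DominationEquivalent : Matrix n n → Matrix n n → Set
DominationEquivalent {n} A M = ∃[ σ ] (∀ (i j : Fin n) →
  (M i ⊑ M j) ⇔ (A (σ ⟨$⟩ʳ i) ⊑ A (σ ⟨$⟩ʳ j)))

powersOfTwo : ∀ n → Vector ℕ n
powersOfTwo n j = 2 ^ toℕ j

module Submission where

-- By Lucas' theorem modulo 2, C(a, b) is odd exactly when the binary digits of
-- b are dominated by those of a.  So the Pascal submatrix of α records precisely
-- the domination relations between the rows of its incidence matrix, and the
-- relabelling of rows in the domination equivalence is itself the permutation
-- giving the similarity.  The entries of β are distinct because rows of A with
-- equal values dominate each other.

open import Defs
open import Algebra.Properties.Semiring.Sum using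
  (sum-cong-≗; sum-replicate-zero; *-distribʳ-sum)
open import Data.Fin.Base using (Fin; zero; suc; toℕ; fromℕ<)
open import Data.Fin.Permutation using (Permutation′; _⟨$⟩ʳ_; _⟨$⟩ˡ_; inverseʳ; inverseˡ)
open import Data.Fin.Properties using (_≟_; toℕ<n; toℕ-injective; toℕ-fromℕ<; suc-injective)
open import Data.Nat.Base using (ℕ; zero; suc; _+_; _*_; _^_; _%_; _/_; _≤_; _<_; z≤n; s≤s)
open import Data.Nat.Combinatorics using (_C_; nCn≡1; nCk+nC[k+1]≡[n+1]C[k+1])
open import Data.Nat.DivMod using
  (%-distribˡ-+; m%n<n; m≡m%n+[m/n]*n; m<n*o⇒m/o<n; m/n/o≡m/[n*o]; m*n%n≡0; n/1≡n)
open import Data.Nat.Properties using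
  (+-*-semiring; *-comm; *-assoc; *-identityʳ; *-zeroʳ; +-identityʳ; +-monoˡ-≤; *-monoˡ-≤;
   ≤-antisym; ≤-trans; m^n≢0; 0≢1+n)
open import Data.Product.Base using (Σ-syntax; _×_; _,_)
open import Data.Sum.Base using (_⊎_; inj₁; inj₂)
open import Data.Vec.Functional using (Vector; head; tail; transpose)
open import Function.Base using (_∘_)
open import Function.Bundles using (_⇔_; mk⇔; Equivalence)
open import Function.Definitions using (Injective)
open import Relation.Binary.PropositionalEquality using
  (_≡_; _≢_; _≗_; refl; sym; trans; cong; cong₂; subst; module ≡-Reasoning)
open import Relation.Nullary using (yes; no; contradiction)

open Equivalence using (to; from)
open ≡-Reasoning

-- Parity of binomial coefficients.

%2-boolean : ∀ a → a % 2 ≡ 0 ⊎ a % 2 ≡ 1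
%2-boolean a with a % 2 | m%n<n a 2
... | 0 | _ = inj₁ refl
... | 1 | _ = inj₂ refl
... | suc (suc _) | s≤s (s≤s ())

boolean-ext : ∀ {a b} → a ≡ 0 ⊎ a ≡ 1 → b ≡ 0 ⊎ b ≡ 1 → (a ≡ 1 ⇔ b ≡ 1) → a ≡ b
boolean-ext (inj₁ a≡0) (inj₁ b≡0) a⇔b = trans a≡0 (sym b≡0)
boolean-ext (inj₂ a≡1) _          a⇔b = trans a≡1 (sym (to a⇔b a≡1))
boolean-ext (inj₁ a≡0) (inj₂ b≡1) a⇔b = trans (from a⇔b b≡1) (sym b≡1)

-- Pascal's rule with each neighbour in the row above replaced by any number `x` or `y` of the same
-- parity, so that smaller binomials can be substituted.
pascal-%2 : ∀ n k x y → (n C k) % 2 ≡ x % 2 → (n C suc k) % 2 ≡ y % 2 →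
            (suc n C suc k) % 2 ≡ (x + y) % 2
pascal-%2 n k x y p q = begin
  (suc n C suc k) % 2                   ≡⟨ cong (_% 2) (nCk+nC[k+1]≡[n+1]C[k+1] n k) ⟨
  (n C k + n C suc k) % 2               ≡⟨ %-distribˡ-+ (n C k) (n C suc k) 2 ⟩
  ((n C k) % 2 + (n C suc k) % 2) % 2   ≡⟨ cong₂ (λ u v → (u + v) % 2) p q ⟩
  (x % 2 + y % 2) % 2                   ≡⟨ %-distribˡ-+ x y 2 ⟨
  (x + y) % 2                           ∎

-- Lucas' theorem modulo 2, one pair of final binary digits at a time.
mutual
  lucas₀₀ : ∀ a b → ((a * 2) C (b * 2)) % 2 ≡ (a C b) % 2
  lucas₀₀ zero    zero    = refl
  lucas₀₀ zero    (suc b) = refl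
  lucas₀₀ (suc a) zero    = refl
  -- The row above is the odd row `suc (a * 2)`, whose own row above is `a * 2`; the recursion thus
  -- decreases `a` every two rows. The two residues found recombine by Pascal's rule.
  lucas₀₀ (suc a) (suc b) = trans
    (pascal-%2 (suc (a * 2)) (suc (b * 2)) (a C b) (a C suc b) (lucas₁₁ a b) (lucas₁₀ a (suc b)))
    (cong (_% 2) (nCk+nC[k+1]≡[n+1]C[k+1] a b))

  lucas₀₁ : ∀ a b → ((a * 2) C suc (b * 2)) % 2 ≡ 0
  lucas₀₁ zero    b = refl
  -- Both neighbours in the row above have the parity of `a C b`, so their sum is even.
  lucas₀₁ (suc a) b = trans
    (pascal-%2 (suc (a * 2)) (b * 2) (a C b) (a C b) (lucas₁₀ a b) (lucas₁₁ a b))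
    (trans (cong (_% 2) (m+m≡m*2 (a C b))) (m*n%n≡0 (a C b) 2))
    where
    m+m≡m*2 : ∀ m → m + m ≡ m * 2
    m+m≡m*2 m = trans (cong (m +_) (sym (+-identityʳ m))) (*-comm 2 m)

  lucas₁₀ : ∀ a b → (suc (a * 2) C (b * 2)) % 2 ≡ (a C b) % 2
  lucas₁₀ a zero    = refl
  lucas₁₀ a (suc b) = pascal-%2 (a * 2) (suc (b * 2)) 0 (a C suc b) (lucas₀₁ a b) (lucas₀₀ a (suc b))

  lucas₁₁ : ∀ a b → (suc (a * 2) C suc (b * 2)) % 2 ≡ (a C b) % 2
  lucas₁₁ a b = trans
    (pascal-%2 (a * 2) (b * 2) (a C b) 0 (lucas₀₀ a b) (lucas₀₁ a b))
    (cong (_% 2) (+-identityʳ (a C b)))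

-- Collects the four cases: `r` = 0, `s` = 1 is the only one that violates `s ≤ r`, and there the
-- binomial is even.
lucas-digit : ∀ {r s} a b → r ≡ 0 ⊎ r ≡ 1 → s ≡ 0 ⊎ s ≡ 1 →
  ((r + a * 2) C (s + b * 2)) % 2 ≡ 1 ⇔ (s ≤ r × (a C b) % 2 ≡ 1)
lucas-digit a b (inj₁ refl) (inj₁ refl) =
  mk⇔ (λ p → z≤n , trans (sym (lucas₀₀ a b)) p) (λ (_ , p) → trans (lucas₀₀ a b) p)
lucas-digit a b (inj₁ refl) (inj₂ refl) =
  mk⇔ (λ p → contradiction (trans (sym (lucas₀₁ a b)) p) 0≢1+n) (λ ())
lucas-digit a b (inj₂ refl) (inj₁ refl) =
  mk⇔ (λ p → z≤n , trans (sym (lucas₁₀ a b)) p) (λ (_ , p) → trans (lucas₁₀ a b) p)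
lucas-digit a b (inj₂ refl) (inj₂ refl) =
  mk⇔ (λ p → s≤s z≤n , trans (sym (lucas₁₁ a b)) p) (λ (_ , p) → trans (lucas₁₁ a b) p)

-- Binary values and domination of digit vectors.

binaryValue : ∀ {n} → Vector ℕ n → ℕ
binaryValue {n} x = Σ[ (λ k → x k * powersOfTwo n k) ]

binaryValue-cong : ∀ {n} {x y : Vector ℕ n} → x ≗ y → binaryValue x ≡ binaryValue y
binaryValue-cong {n} x≗y =
  sum-cong-≗ +-*-semiring (λ k → cong (_* powersOfTwo n k) (x≗y k))

-- Horner's step: the head carries the weight 1 and every other weight has a factor 2. This is the
-- shape that `lucas-digit` expects.
binaryValue-suc : ∀ {n} (x : Vector ℕ (suc n)) →
  binaryValue x ≡ head x + binaryValue (tail x) * 2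
binaryValue-suc {n} x = cong₂ _+_ (*-identityʳ (head x)) (begin
  Σ[ (λ k → tail x k * (2 * powersOfTwo n k)) ]
    ≡⟨ sum-cong-≗ +-*-semiring (λ k → trans
         (cong (tail x k *_) (*-comm 2 (powersOfTwo n k)))
         (sym (*-assoc (tail x k) (powersOfTwo n k) 2))) ⟩
  Σ[ (λ k → tail x k * powersOfTwo n k * 2) ]
    ≡⟨ *-distribʳ-sum +-*-semiring 2 (λ k → tail x k * powersOfTwo n k) ⟨
  binaryValue (tail x) * 2 ∎)

binaryValue<2^n : ∀ {n} (x : Vector ℕ n) → (∀ k → x k ≡ 0 ⊎ x k ≡ 1) → binaryValue x < 2 ^ n
binaryValue<2^n {zero}  x _ = s≤s z≤n
binaryValue<2^n {suc n} x bool rewrite binaryValue-suc x | *-comm 2 (2 ^ n) =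
  -- With v the value of the tail and d the head, 1 + d + 2v ≤ 2(1 + v) ≤ 2 · 2ⁿ.
  ≤-trans (s≤s (+-monoˡ-≤ (binaryValue (tail x) * 2) (digit≤1 (bool zero))))
          (*-monoˡ-≤ 2 (binaryValue<2^n (tail x) (bool ∘ suc)))
  where
  digit≤1 : ∀ {d} → d ≡ 0 ⊎ d ≡ 1 → d ≤ 1
  digit≤1 (inj₁ refl) = z≤n
  digit≤1 (inj₂ refl) = s≤s z≤n

bit-suc : ∀ a j → bit a (suc j) ≡ bit (a / 2) j
bit-suc a j = cong (_% 2) (sym (m/n/o≡m/[n*o] a 2 (2 ^ j)))
  where instance
    _ = m^n≢0 2 j
    _ = m^n≢0 2 (suc j)

-- Induction by halving: the last bit is the remainder, the others are the bits of `a / 2`, and the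
-- bound ensures that `n` bits exhaust `a`.
binaryValue-bits : ∀ n {a} → a < 2 ^ n → binaryValue {n} (λ j → bit a (toℕ j)) ≡ a
binaryValue-bits zero    {zero}  _ = refl
binaryValue-bits zero    {suc _} (s≤s ())
binaryValue-bits (suc n) {a} a<2^[1+n] = begin
  binaryValue {suc n} (λ j → bit a (toℕ j))
    ≡⟨ binaryValue-suc {n} (λ j → bit a (toℕ j)) ⟩
  bit a 0 + binaryValue {n} (λ j → bit a (suc (toℕ j))) * 2
    ≡⟨ cong₂ (λ u v → u % 2 + v * 2) (n/1≡n a) (begin
         binaryValue {n} (λ j → bit a (suc (toℕ j))) ≡⟨ binaryValue-cong {n} (λ j → bit-suc a (toℕ j)) ⟩
         binaryValue {n} (λ j → bit (a / 2) (toℕ j)) ≡⟨ binaryValue-bits n a/2<2^n ⟩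
         a / 2                                       ∎) ⟩
  a % 2 + a / 2 * 2
    ≡⟨ m≡m%n+[m/n]*n a 2 ⟨
  a ∎
  where
  a/2<2^n : a / 2 < 2 ^ n
  a/2<2^n = m<n*o⇒m/o<n (subst (a <_) (*-comm 2 (2 ^ n)) a<2^[1+n])

-- Lucas' theorem for all digits at once: each step compares the heads and passes to the tails, down
-- to `0 C 0`, which is 1.
C-odd⇔⊑ : ∀ {n} {x y : Vector ℕ n} → (∀ k → x k ≡ 0 ⊎ x k ≡ 1) → (∀ k → y k ≡ 0 ⊎ y k ≡ 1) →
  (binaryValue x C binaryValue y) % 2 ≡ 1 ⇔ y ⊑ x
C-odd⇔⊑ {zero}  _  _ = mk⇔ (λ _ ()) (λ _ → refl)
C-odd⇔⊑ {suc n} {x} {y} bx by rewrite binaryValue-suc x | binaryValue-suc y =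
  mk⇔ (λ odd → let y₀≤x₀ , odd′ = to digit odd in
                λ { zero → y₀≤x₀ ; (suc k) → to rest odd′ k })
      (λ y⊑x → from digit (y⊑x zero , from rest (y⊑x ∘ suc)))
  where
  digit = lucas-digit (binaryValue (tail x)) (binaryValue (tail y)) (bx zero) (by zero)
  rest = C-odd⇔⊑ {n} {tail x} {tail y} (bx ∘ suc) (by ∘ suc)

-- Equal values v give the odd coefficient `v C v`, which is 1, so the criterion above applies.
binaryValue≡⇒⊑ : ∀ {n} {x y : Vector ℕ n} →
  (∀ k → x k ≡ 0 ⊎ x k ≡ 1) → (∀ k → y k ≡ 0 ⊎ y k ≡ 1) →
  binaryValue x ≡ binaryValue y → y ⊑ x
binaryValue≡⇒⊑ {x = x} {y} bx by x≡y = to (C-odd⇔⊑ bx by) (cong (_% 2)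
  (trans (cong (_C binaryValue y) x≡y) (nCn≡1 (binaryValue y))))

incidenceMatrix-boolean : ∀ {n} (α : Q n) → IsBoolean (incidenceMatrix α)
incidenceMatrix-boolean α i j = %2-boolean (toℕ (elements α i) / 2 ^ toℕ j)
  where instance _ = m^n≢0 2 (toℕ j)

binaryValue-incidenceMatrix : ∀ {n} (α : Q n) i →
  binaryValue (incidenceMatrix α i) ≡ toℕ (elements α i)
binaryValue-incidenceMatrix {n} α i = binaryValue-bits n (toℕ<n (elements α i))

-- Mutual domination makes the two rows equal, and a row determines its element of `α`.
⊑-incidenceMatrix-injective : ∀ {n} (α : Q n) {i j} →
  incidenceMatrix α i ⊑ incidenceMatrix α j → incidenceMatrix α j ⊑ incidenceMatrix α i → i ≡ j
⊑-incidenceMatrix-injective α {i} {j} i⊑j j⊑i = distinct α (toℕ-injective (begin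
  toℕ (elements α i)                ≡⟨ binaryValue-incidenceMatrix α i ⟨
  binaryValue (incidenceMatrix α i) ≡⟨ binaryValue-cong (λ k → ≤-antisym (i⊑j k) (j⊑i k)) ⟩
  binaryValue (incidenceMatrix α j) ≡⟨ binaryValue-incidenceMatrix α j ⟩
  toℕ (elements α j)                ∎))

-- Conjugation by permutation matrices.

sum-zero : ∀ {n} {f : Vector ℕ n} → (∀ k → f k ≡ 0) → Σ[ f ] ≡ 0
sum-zero {n} f≡0 = trans (sum-cong-≗ +-*-semiring f≡0) (sum-replicate-zero +-*-semiring n)

sum-supported-at : ∀ {n} {f : Vector ℕ n} i → (∀ k → k ≢ i → f k ≡ 0) → Σ[ f ] ≡ f i
sum-supported-at {f = f} zero f≡0 =
  trans (cong (f zero +_) (sum-zero (λ k → f≡0 (suc k) λ ()))) (+-identityʳ (f zero))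
sum-supported-at (suc i) f≡0 =
  cong₂ _+_ (f≡0 zero λ ()) (sum-supported-at i (λ k k≢i → f≡0 (suc k) (k≢i ∘ suc-injective)))

-- With the next lemma, this locates the single nonzero entry of column `i`, so that products with
-- the matrix collapse to one term.
permutationMatrix-≡1 : ∀ {n} (σ : Permutation′ n) i → permutationMatrix σ (σ ⟨$⟩ˡ i) i ≡ 1
permutationMatrix-≡1 σ i with σ ⟨$⟩ʳ (σ ⟨$⟩ˡ i) ≟ i
... | yes _ = refl
... | no σi≢i = contradiction (inverseʳ σ) σi≢i

permutationMatrix-≡0 : ∀ {n} (σ : Permutation′ n) i k → k ≢ σ ⟨$⟩ˡ i → permutationMatrix σ k i ≡ 0
permutationMatrix-≡0 σ i k k≢ with σ ⟨$⟩ʳ k ≟ i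
... | yes refl = contradiction (sym (inverseˡ σ)) k≢
... | no _ = refl

·-permutationMatrix : ∀ {m n} (M : Matrix m n) (σ : Permutation′ n) i j →
  (M · permutationMatrix σ) i j ≡ M i (σ ⟨$⟩ˡ j)
·-permutationMatrix M σ i j = trans
  (sum-supported-at (σ ⟨$⟩ˡ j) (λ k k≢ →
    trans (cong (M i k *_) (permutationMatrix-≡0 σ j k k≢)) (*-zeroʳ (M i k))))
  (trans (cong (M i (σ ⟨$⟩ˡ j) *_) (permutationMatrix-≡1 σ j)) (*-identityʳ _))

permutationMatrixᵀ-· : ∀ {m n} (M : Matrix m n) (σ : Permutation′ m) i j →
  (transpose (permutationMatrix σ) · M) i j ≡ M (σ ⟨$⟩ˡ i) j
permutationMatrixᵀ-· M σ i j = trans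
  (sum-supported-at (σ ⟨$⟩ˡ i) (λ k k≢ → cong (_* M k j) (permutationMatrix-≡0 σ i k k≢)))
  (trans (cong (_* M (σ ⟨$⟩ˡ i) j) (permutationMatrix-≡1 σ i)) (+-identityʳ _))

-- Conjugation reindexes rows and columns by the inverse of `σ`, whereas `DominationEquivalent`
-- supplies data along `σ` itself.
relabelling⇒∼ : ∀ {n} {M N : Matrix n n} (σ : Permutation′ n) →
  (∀ i j → N (σ ⟨$⟩ʳ i) (σ ⟨$⟩ʳ j) ≡ M i j) → M ∼ N
relabelling⇒∼ {M = M} {N} σ N≡M = σ , λ i j → begin
  N i j
    ≡⟨ cong₂ N (inverseʳ σ) (inverseʳ σ) ⟨
  N (σ ⟨$⟩ʳ (σ ⟨$⟩ˡ i)) (σ ⟨$⟩ʳ (σ ⟨$⟩ˡ j))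
    ≡⟨ N≡M (σ ⟨$⟩ˡ i) (σ ⟨$⟩ˡ j) ⟩
  M (σ ⟨$⟩ˡ i) (σ ⟨$⟩ˡ j)
    ≡⟨ permutationMatrixᵀ-· M σ i (σ ⟨$⟩ˡ j) ⟨
  (transpose (permutationMatrix σ) · M) i (σ ⟨$⟩ˡ j)
    ≡⟨ ·-permutationMatrix (transpose (permutationMatrix σ) · M) σ i j ⟨
  (transpose (permutationMatrix σ) · M · permutationMatrix σ) i j ∎

-- Pascal submatrices and the theorem.

pascalMatrix-boolean : ∀ {n} (α : Q n) → IsBoolean pascalMatrix[ α ]
pascalMatrix-boolean α i j = %2-boolean (toℕ (elements α i) C toℕ (elements α j))

-- The order is reversed because the row index is the upper argument of the binomial. `B` is general
-- so as to cover both `A` and the incidence matrix of `α`.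
pascalMatrix-odd⇔⊑ : ∀ {n} (α : Q n) {B : Matrix n n} → IsBoolean B →
  (∀ i → toℕ (elements α i) ≡ binaryValue (B i)) →
  ∀ i j → pascalMatrix[ α ] i j ≡ 1 ⇔ B j ⊑ B i
pascalMatrix-odd⇔⊑ α bool α≡B i j rewrite α≡B i | α≡B j = C-odd⇔⊑ (bool i) (bool j)

theorem4p2 : ∀ (n : ℕ) (α : Q n) (A : Matrix n n) →
    IsBoolean A →
    DominationEquivalent A (incidenceMatrix α) →
    (β : Vector ℕ n) →
    (∀ i → (A ·ᵥ powersOfTwo n) i ≡ β i) →
    Σ[ β′ ∈ Q n ] ((∀ i → toℕ (elements β′ i) ≡ β i) × PascalEquivalent α β′)
theorem4p2 n α A bool (σ , dom) β Av≡β =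
  β′ , (λ i → trans (β′≡A i) (Av≡β i)) , relabelling⇒∼ σ λ i j →
    let β′-odd = pascalMatrix-odd⇔⊑ β′ bool β′≡A (σ ⟨$⟩ʳ i) (σ ⟨$⟩ʳ j)
        α-odd  = pascalMatrix-odd⇔⊑ α (incidenceMatrix-boolean α)
                   (λ k → sym (binaryValue-incidenceMatrix α k)) i j
    in boolean-ext
         (pascalMatrix-boolean β′ (σ ⟨$⟩ʳ i) (σ ⟨$⟩ʳ j)) (pascalMatrix-boolean α i j)
         (mk⇔ (from α-odd ∘ from (dom j i) ∘ to β′-odd)
              (from β′-odd ∘ to (dom j i) ∘ to α-odd))
  where
  A<2^n : ∀ i → binaryValue (A i) < 2 ^ n
  A<2^n i = binaryValue<2^n (A i) (bool i)

  β′-elements : Vector (Fin (2 ^ n)) n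
  β′-elements i = fromℕ< (A<2^n i)

  β′≡A : ∀ i → toℕ (β′-elements i) ≡ binaryValue (A i)
  β′≡A i = toℕ-fromℕ< (A<2^n i)

  -- Phrased on images under `σ`, where `dom` can carry the mutual domination back to rows `i` and
  -- `j` of the incidence matrix.
  binaryValue-A-injective : ∀ i j → binaryValue (A (σ ⟨$⟩ʳ i)) ≡ binaryValue (A (σ ⟨$⟩ʳ j)) → i ≡ j
  binaryValue-A-injective i j eq = ⊑-incidenceMatrix-injective α
    (from (dom i j) (binaryValue≡⇒⊑ (bool _) (bool _) (sym eq)))
    (from (dom j i) (binaryValue≡⇒⊑ (bool _) (bool _) eq))

  β′-injective : Injective _≡_ _≡_ β′-elements
  β′-injective {i} {j} eq = begin
    -- Every row index of `A` is an image under `σ`, so injectivity on images suffices.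
    i                     ≡⟨ inverseʳ σ ⟨
    σ ⟨$⟩ʳ (σ ⟨$⟩ˡ i)     ≡⟨ cong (σ ⟨$⟩ʳ_) (binaryValue-A-injective (σ ⟨$⟩ˡ i) (σ ⟨$⟩ˡ j) (begin
        binaryValue (A (σ ⟨$⟩ʳ (σ ⟨$⟩ˡ i))) ≡⟨ cong (binaryValue ∘ A) (inverseʳ σ) ⟩
        binaryValue (A i)                   ≡⟨ β′≡A i ⟨
        toℕ (β′-elements i)                 ≡⟨ cong toℕ eq ⟩
        toℕ (β′-elements j)                 ≡⟨ β′≡A j ⟩
        binaryValue (A j)                   ≡⟨ cong (binaryValue ∘ A) (inverseʳ σ) ⟨
        binaryValue (A (σ ⟨$⟩ʳ (σ ⟨$⟩ˡ j))) ∎)) ⟩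
    σ ⟨$⟩ʳ (σ ⟨$⟩ˡ j)     ≡⟨ inverseʳ σ ⟩
    j                     ∎

  β′ : Q n
  β′ = record { elements = β′-elements ; distinct = β′-injective }
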